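{- Let $K\subseteq V_{\mathbf B}$ be a class of $\mathbf B$-models and let $(M_1,w_1)$ and $(M_2,w_2)$ be two pointed models with $M_1,M_2\in K$, with sets of worlds $W_1,W_2$. Let $\kappa$ be the least infinite cardinal $\geq\sup\{|W_1|,|W_2|\}$ and $\lambda=\sup\{|\mathtt{PROP}|,2^{\kappa}\}$. Then, when $\{i,j\}=\{1,2\}$, there is a formula $\theta^{w_i}$ of $L_{\lambda^+\omega}^{\rightarrow}$ such that (1) $M_i,w_i\Vdash\theta^{w_i}$, and (2) $M_j,w_j\Vdash\theta^{w_i}$ if and only if there is a relevant directed bisimulation $\langle Z_1,Z_2\rangle$ for $\mathtt{PROP}$ between $M_1$ and $M_2$ such that $w_iZ_iw_j$.
   Context: Language. Given a set $\mathtt{PROP}$ of propositional variables and an infinite cardinal $\mu$, the formulas of $L_{\mu\omega}^{\rightarrow}$ are generated by $\phi ::= p \mid \bot \mid {\sim}\phi \mid \bigwedge_{i\in I}\phi_i \mid \bigvee_{i\in I}\phi_i \mid \phi\rightarrow\psi$, with $p\in\mathtt{PROP}$ and $|I|<\mu$. Models. A (Routley–Meyer) model is $M=\langle W,R,*,T,V\rangle$ with $W$ a non-empty set, $T\in W$, $*:W\to W$ (written $w\mapsto w^*$), $R\subseteq W^3$, and $V:\mathtt{PROP}\to\wp(W)$. A pointed model is a pair $(M,w)$ with $w\in W$. Satisfaction: $M,w\Vdash\bot$ never; $M,w\Vdash p$ iff $w\in V(p)$; $M,w\Vdash{\sim}\phi$ iff $M,w^*\nVdash\phi$; $M,w\Vdash\bigwedge_{i\in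 I}\phi_i$ iff $M,w\Vdash\phi_i$ for every $i\in I$; $M,w\Vdash\bigvee_{i\in I}\phi_i$ iff $M,w\Vdash\phi_i$ for some $i\in I$; $M,w\Vdash\phi\rightarrow\psi$ iff for all $a,b$ with $Rwab$, if $M,a\Vdash\phi$ then $M,b\Vdash\psi$. A $\mathbf B$-model is a model such that for all $x,y,z,v\in W$: $RTxx$; $RTxv$ and $Rvyz$ imply $Rxyz$; $x=x^{**}$; $RTxy$ implies $RTy^*x^*$; and $x\in V(p)$ and $RTxy$ imply $y\in V(p)$ for all $p\in\mathtt{PROP}$. $V_{\mathbf B}$ is the class of all $\mathbf B$-models. Relevant directed bisimulations. Let $M_1,M_2$ be models with components $W_m,R_m,*_m,V_m$ ($m=1,2$). A relevant directed bisimulation for $\mathtt{PROP}$ between $M_1$ and $M_2$ is a pair $\langle Z_1,Z_2\rangle$ of non-empty relations $Z_1\subseteq W_1\times W_2$, $Z_2\subseteq W_2\times W_1$ such that whenever $\{i,j\}=\{1,2\}$: (1) $xZ_iy$ only if $y^{*_j}Z_jx^{*_i}$; (2) if $xZ_iy$ and $R_jybc$ for some $b,c\in W_j$, there are $b',c'\in W_i$ such that $R_ixb'c'$, $bZ_jb'$ and $c'Z_ic$; (3) if $xZ_iy$ and $p\in\mathtt{PROP}$, then $M_i,x\Vdash p$ only if $M_j,y\Vdash p$. -}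

module Defs where

open import Data.Bool.Base using (Bool)
open import Data.Empty.Polymorphic using (⊥)
open import Data.Nat.Base using (ℕ)
open import Data.Product.Base using (_×_; ∃; ∃₂)
open import Function.Bundles using (_↣_)
open import Level using (Level; suc)
open import Relation.Binary.Core using (REL)
open import Relation.Binary.PropositionalEquality.Core using (_≡_)
open import Relation.Nullary.Negation.Core using (¬_)
open import Relation.Unary using (Pred; _∈_)

private
  variable
    ℓ : Level

-- Sets are the types in Set ℓ, and a cardinal is given by any type of that
-- cardinality: |A| ≤ |B| is A ↣ B, and a cardinal with a minimality property
-- is determined by it up to equinumerosity.

infix 4 _≺_

_≺_ : Set ℓ → Set ℓ → Set ℓ
A ≺ B = (A ↣ B) × ¬ (B ↣ A)

Infinite : Set ℓ → Set ℓ
Infinite A = ℕ ↣ A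

2^_ : Set ℓ → Set ℓ
2^ A = A → Bool

record IsSup (S A B : Set ℓ) : Set (suc ℓ) where
  field
    upperˡ : A ↣ S
    upperʳ : B ↣ S
    least  : ∀ (X : Set ℓ) → A ↣ X → B ↣ X → S ↣ X

record IsLeastInfiniteAbove (K A : Set ℓ) : Set (suc ℓ) where
  field
    infinite : Infinite K
    above    : A ↣ K
    least    : ∀ (X : Set ℓ) → Infinite X → A ↣ X → K ↣ X

record IsSuccessor (B A : Set ℓ) : Set (suc ℓ) where
  field
    above : A ≺ B
    least : ∀ (X : Set ℓ) → A ≺ X → B ↣ X

infixr 5 _⇒_
infix  7 ∼_

-- The formulas of L→_{μω}.
data Formula (PROP μ : Set ℓ) : Set (suc ℓ) where
  atom : PROP → Formula PROP μ
  bot  : Formula PROP μ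
  ∼_   : Formula PROP μ → Formula PROP μ
  ⋀    : (I : Set ℓ) → I ≺ μ → (I → Formula PROP μ) → Formula PROP μ
  ⋁    : (I : Set ℓ) → I ≺ μ → (I → Formula PROP μ) → Formula PROP μ
  _⇒_  : Formula PROP μ → Formula PROP μ → Formula PROP μ

record Model (PROP : Set ℓ) : Set (suc ℓ) where
  infix 8 _⋆
  field
    W  : Set ℓ
    R  : W → W → W → Set ℓ
    _⋆ : W → W
    T  : W
    V  : PROP → Pred W ℓ

infix 4 _,_⊩_

_,_⊩_ : {PROP μ : Set ℓ} (M : Model PROP) → Model.W M → Formula PROP μ → Set ℓ
M , w ⊩ atom p  = w ∈ Model.V M p
M , w ⊩ bot     = ⊥
M , w ⊩ ∼ φ     = ¬ (M , Model._⋆ M w ⊩ φ)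
M , w ⊩ ⋀ I _ φ = ∀ (i : I) → M , w ⊩ φ i
M , w ⊩ ⋁ I _ φ = ∃ λ (i : I) → M , w ⊩ φ i
M , w ⊩ φ ⇒ ψ   = ∀ a b → Model.R M w a b → M , a ⊩ φ → M , b ⊩ ψ

record IsBModel {PROP : Set ℓ} (M : Model PROP) : Set ℓ where
  open Model M
  field
    R-refl    : ∀ x → R T x x
    R-trans   : ∀ x y z v → R T x v → R v y z → R x y z
    ⋆-invol   : ∀ x → x ≡ x ⋆ ⋆
    ⋆-anti    : ∀ x y → R T x y → R T (y ⋆) (x ⋆)
    V-persist : ∀ p x y → x ∈ V p → R T x y → y ∈ V p

-- Clauses (1)–(3) of a relevant directed bisimulation, for one of the two
-- choices of i and j: here M = Mᵢ, N = Mⱼ, Z = Zᵢ and Z′ = Zⱼ.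
record Directed {PROP : Set ℓ} (M N : Model PROP)
                (Z : REL (Model.W M) (Model.W N) ℓ)
                (Z′ : REL (Model.W N) (Model.W M) ℓ) : Set ℓ where
  private
    module M = Model M
    module N = Model N
  field
    star : ∀ x y → Z x y → Z′ (y N.⋆) (x M.⋆)
    back : ∀ x y → Z x y → ∀ b c → N.R y b c →
           ∃₂ λ b′ c′ → M.R x b′ c′ × Z′ b b′ × Z c′ c
    prop : ∀ x y → Z x y → ∀ p → x ∈ M.V p → y ∈ N.V p

record DirectedBisimulation {PROP : Set ℓ} (M₁ M₂ : Model PROP) : Set (suc ℓ) where
  field
    Z₁          : REL (Model.W M₁) (Model.W M₂) ℓ
    Z₂          : REL (Model.W M₂) (Model.W M₁) ℓ
    Z₁-nonempty : ∃₂ λ x y → Z₁ x y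
    Z₂-nonempty : ∃₂ λ x y → Z₂ x y
    directed₁₂  : Directed M₁ M₂ Z₁ Z₂
    directed₂₁  : Directed M₂ M₁ Z₂ Z₁

{-# OPTIONS --safe #-}

-- Let x ≼ y say that every formula true at x is true at y. Directed
-- bisimulations are contained in ≼, and ≼ (in both directions) is itself one:
-- if R y b c has no match at x, choose for every b′ with b ⋠ b′ a formula true
-- at b but not at b′, and for every c′ with c′ ⋠ c a formula true at c′ but not
-- at c; the conjunction of the former implies the disjunction of the latter at
-- x but not at y. Hence the conjunction over all y of a formula true at w but
-- not at y, when there is one, is true exactly at the worlds directedly
-- bisimilar to w. No choice principle is needed beyond excluded middle, since
-- deciding a Σ-type already returns a witness.

module Submission where

open import Axiom.ExcludedMiddle using (ExcludedMiddle)
open import Data.Bool.Base using (T)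
open import Data.Product using (_×_; ∃; _,_; proj₁; proj₂)
open import Function.Base using (_∘_)
open import Function.Bundles using (_⇔_; _↣_; mk↣; mk⇔)
open import Function.Construct.Composition using (_↣-∘_; _⇔-∘_)
open import Level using (Level; suc; Lift; lift; lower)
open import Relation.Binary.Core using (REL)
open import Relation.Binary.PropositionalEquality using (_≡_; refl; sym; subst; cong-app)
open import Relation.Nullary.Decidable
  using (yes; no; map′; decidable-stable; isYes; True; toWitness; fromWitness)
open import Relation.Nullary.Negation using (¬_; contradiction)
open import Relation.Unary using (Pred; _∈_; _⊆_)
open import Defs

open Model using (W; R; _⋆)

private
  variable
    ℓ : Level
    A B C PROP μ : Set ℓ

lowerExcludedMiddle : ExcludedMiddle (suc ℓ) → ExcludedMiddle ℓ
lowerExcludedMiddle {ℓ} em = map′ lower lift (em {Lift (suc ℓ) _})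

↣-≺-trans : A ↣ B → B ≺ C → A ≺ C
↣-≺-trans f (g , ¬g) = g ↣-∘ f , λ h → ¬g (f ↣-∘ h)

A↣2^A : ExcludedMiddle ℓ → (A : Set ℓ) → A ↣ 2^ A
-- Comparing the two indicator functions at `x` turns the truth of `x ≡ x` into that of `y ≡ x`.
A↣2^A em A = mk↣ {to = singleton} λ {x} {y} eq →
  sym (toWitness {a? = em} (subst T (cong-app eq x) (fromWitness {a? = em} refl)))
  where
  singleton : A → 2^ A
  singleton x y = isYes (em {x ≡ y})

flipBisimulation : {M N : Model PROP} → DirectedBisimulation M N → DirectedBisimulation N M
flipBisimulation B = record
  { Z₁          = Z₂
  ; Z₂          = Z₁
  ; Z₁-nonempty = Z₂-nonempty
  ; Z₂-nonempty = Z₁-nonempty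
  ; directed₁₂  = directed₂₁
  ; directed₂₁  = directed₁₂
  }
  where open DirectedBisimulation B

-- Induction on the formula, in both directions at once: `∼` and the antecedent of `⇒` swap the
-- roles of `Z` and `Z′`.
directed-preserves : {M N : Model PROP} {Z : REL (W M) (W N) _} {Z′ : REL (W N) (W M) _} →
  Directed M N Z Z′ → Directed N M Z′ Z → (φ : Formula PROP μ) →
  ∀ x y → Z x y → M , x ⊩ φ → N , y ⊩ φ
directed-preserves d d′ (atom p) x y xZy h = Directed.prop d x y xZy p h
directed-preserves d d′ (∼ φ) x y xZy h =
  h ∘ directed-preserves d′ d φ _ _ (Directed.star d x y xZy)
directed-preserves d d′ (⋀ I _ φ) x y xZy h i = directed-preserves d d′ (φ i) x y xZy (h i)
directed-preserves d d′ (⋁ I _ φ) x y xZy (i , h) = i , directed-preserves d d′ (φ i) x y xZy h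
directed-preserves d d′ (φ ⇒ ψ)     x y xZy h b c yRbc b⊩φ
  with b′ , c′ , xRb′c′ , bZ′b′ , c′Zc ← Directed.back d x y xZy b c yRbc =
  directed-preserves d d′ ψ c′ c c′Zc
    (h b′ c′ xRb′c′ (directed-preserves d′ d φ b b′ bZ′b′ b⊩φ))

module _ {ℓ : Level} (em : ExcludedMiddle (suc ℓ)) {PROP : Set ℓ} (μ : Set ℓ) where

  module _ (M N : Model PROP) where

    infix 4 _≼_

    _≼_ : W M → W N → Set (suc ℓ)
    x ≼ y = (φ : Formula PROP μ) → M , x ⊩ φ → N , y ⊩ φ

    -- Z in a DirectedBisimulation is a relation in Set ℓ, one level below ≼.
    _≼′_ : REL (W M) (W N) ℓ
    x ≼′ y = Lift ℓ (True (em {x ≼ y}))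

    Separates : W M → W N → Formula PROP μ → Set ℓ
    Separates x y φ = (M , x ⊩ φ) × ¬ (N , y ⊩ φ)

    -- The default `χ` makes the family total, so that it can be indexed by all worlds. It will be
    -- the neutral element: `∼ bot` under `⋀`, `bot` under `⋁`.
    separatorOr : Formula PROP μ → W M → W N → Formula PROP μ
    separatorOr χ x y with em {∃ (Separates x y)}
    ... | yes (φ , _) = φ
    ... | no  _       = χ

  module _ {M N : Model PROP} where

    to≼′ : ∀ {x y} → _≼_ M N x y → _≼′_ M N x y
    to≼′ = lift ∘ fromWitness

    from≼′ : ∀ {x y} → _≼′_ M N x y → _≼_ M N x y
    from≼′ = toWitness ∘ lower

    inseparable⇒≼ : ∀ {x y} → ¬ ∃ (Separates M N x y) → _≼_ M N x y
    inseparable⇒≼ none φ x⊩φ =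
      decidable-stable (lowerExcludedMiddle em) λ y⊮φ → none (φ , x⊩φ , y⊮φ)

    separatorOr-holds : ∀ {χ} x y → M , x ⊩ χ → M , x ⊩ separatorOr M N χ x y
    separatorOr-holds x y x⊩χ with em {∃ (Separates M N x y)}
    ... | yes (_ , x⊩φ , _) = x⊩φ
    ... | no  _             = x⊩χ

    separatorOr-fails : ∀ {χ} x y → ¬ (N , y ⊩ χ) → ¬ (N , y ⊩ separatorOr M N χ x y)
    separatorOr-fails x y y⊮χ with em {∃ (Separates M N x y)}
    ... | yes (_ , _ , y⊮φ) = y⊮φ
    ... | no  _             = y⊮χ

    ⋠⇒separatorOr-holds : ∀ {χ} x y → ¬ _≼_ M N x y → M , x ⊩ separatorOr M N χ x y
    ⋠⇒separatorOr-holds x y x⋠y with em {∃ (Separates M N x y)}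
    ... | yes (_ , x⊩φ , _) = x⊩φ
    ... | no  none          = contradiction (inseparable⇒≼ none) x⋠y

    -- A separator would fail at `y`, so truth at `y` shows that none exists.
    separatorOr-holds⇒≼ : ∀ {χ} x y → N , y ⊩ separatorOr M N χ x y → _≼_ M N x y
    separatorOr-holds⇒≼ x y h with em {∃ (Separates M N x y)}
    ... | yes (_ , _ , y⊮φ) = contradiction h y⊮φ
    ... | no  none          = inseparable⇒≼ none

  module _ (M N : Model PROP) (|M|≺μ : W M ≺ μ) where

    -- Negation is evaluated at the starred world, so passing `∼ φ` from `x` to `y` passes `φ` from
    -- the star of `y` back to that of `x`.
    ≼-star : ∀ x y → _≼_ M N x y → _≼_ N M ((N ⋆) y) ((M ⋆) x)
    ≼-star x y x≼y φ y⋆⊩φ =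
      decidable-stable (lowerExcludedMiddle em) λ x⋆⊮φ → x≼y (∼ φ) x⋆⊮φ y⋆⊩φ

    ≼-back : ∀ x y → _≼_ M N x y → ∀ b c → R N y b c →
      ∃ λ b′ → ∃ λ c′ → R M x b′ c′ × _≼_ N M b b′ × _≼_ M N c′ c
    ≼-back x y x≼y b c yRbc = decidable-stable em λ none →
      let
        Φ = ⋀ (W M) |M|≺μ (separatorOr N M (∼ bot) b)
        Ψ = ⋁ (W M) |M|≺μ (λ c′ → separatorOr M N bot c′ c)

        x⊩Φ⇒Ψ : M , x ⊩ Φ ⇒ Ψ
        -- The conjunct of `Φ` at `b′` gives `b ≼ b′`, so `none` rules out `c′ ≼ c` and the disjunct
        -- of `Ψ` at `c′` holds.
        x⊩Φ⇒Ψ b′ c′ xRb′c′ b′⊩Φ = c′ , ⋠⇒separatorOr-holds c′ c λ c′≼c →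
          none (b′ , c′ , xRb′c′ , separatorOr-holds⇒≼ b b′ (b′⊩Φ b′) , c′≼c)

        -- `Φ` holds at `b`, which forces `Ψ` at `c`, where every disjunct fails. Here `lower` is
        -- the proof of `∼ bot`.
        c⊩Ψ = x≼y (Φ ⇒ Ψ) x⊩Φ⇒Ψ b c yRbc λ b′ → separatorOr-holds b b′ lower
      in separatorOr-fails (proj₁ c⊩Ψ) c lower (proj₂ c⊩Ψ)

    ≼′-directed : Directed M N (_≼′_ M N) (_≼′_ N M)
    ≼′-directed = record
      { star = λ x y x≼y → to≼′ (≼-star x y (from≼′ x≼y))
      ; back = λ x y x≼y b c yRbc →
          let b′ , c′ , xRb′c′ , b≼b′ , c′≼c = ≼-back x y (from≼′ x≼y) b c yRbc
          in b′ , c′ , xRb′c′ , to≼′ b≼b′ , to≼′ c′≼c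
      ; prop = λ x y x≼y p → from≼′ x≼y (atom p)
      }

  module _ (M N : Model PROP) (|M|≺μ : W M ≺ μ) (|N|≺μ : W N ≺ μ) where

    ≼⇔bisimilar : ∀ x y → _≼_ M N x y ⇔ ∃ λ (B : DirectedBisimulation M N) → DirectedBisimulation.Z₁ B x y
    ≼⇔bisimilar x y = mk⇔
      (λ x≼y → record
        { Z₁          = _≼′_ M N
        ; Z₂          = _≼′_ N M
        ; Z₁-nonempty = x , y , to≼′ x≼y
        -- Starring the given pair yields a pair in the reverse relation.
        ; Z₂-nonempty = (N ⋆) y , (M ⋆) x , to≼′ (≼-star M N |M|≺μ x y x≼y)
        ; directed₁₂  = ≼′-directed M N |M|≺μ
        ; directed₂₁  = ≼′-directed N M |N|≺μ
        } , to≼′ x≼y)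
      (λ (B , xZy) φ → let open DirectedBisimulation B in
        directed-preserves directed₁₂ directed₂₁ φ x y xZy)

    characteristicFormula : ∀ w → ∃ λ (θ : Formula PROP μ) → (M , w ⊩ θ) ×
      (∀ v → (N , v ⊩ θ) ⇔ (∃ λ (B : DirectedBisimulation M N) → DirectedBisimulation.Z₁ B w v))
    characteristicFormula w = θ , w⊩θ , λ v →
      -- The conjunct at `v` alone gives `w ≼ v`; conversely, `w ≼ v` is applied to `θ` itself.
      ≼⇔bisimilar w v ⇔-∘ mk⇔ (λ v⊩θ → separatorOr-holds⇒≼ w v (v⊩θ v)) (λ w≼v → w≼v θ w⊩θ)
      where
      θ : Formula PROP μ
      θ = ⋀ (W N) |N|≺μ (separatorOr M N (∼ bot) w)

      w⊩θ : M , w ⊩ θ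
      w⊩θ y = separatorOr-holds w y lower

theorem8 : ∀ {ℓ k : Level} → ExcludedMiddle (suc ℓ) →
    (PROP : Set ℓ) (K : Pred (Model PROP) k) → K ⊆ IsBModel →
    (M₁ M₂ : Model PROP) → M₁ ∈ K → M₂ ∈ K →
    (w₁ : Model.W M₁) (w₂ : Model.W M₂) →
    (σ κ Λ Λ⁺ : Set ℓ) →
    IsSup σ (Model.W M₁) (Model.W M₂) →
    IsLeastInfiniteAbove κ σ →
    IsSup Λ PROP (2^ κ) →
    IsSuccessor Λ⁺ Λ →
    (∃ λ (θ : Formula PROP Λ⁺) →
    (M₁ , w₁ ⊩ θ) ×
    ((M₂ , w₂ ⊩ θ) ⇔ (∃ λ (B : DirectedBisimulation M₁ M₂) → DirectedBisimulation.Z₁ B w₁ w₂))) ×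
    (∃ λ (θ : Formula PROP Λ⁺) →
    (M₂ , w₂ ⊩ θ) ×
    ((M₁ , w₁ ⊩ θ) ⇔ (∃ λ (B : DirectedBisimulation M₁ M₂) → DirectedBisimulation.Z₂ B w₂ w₁)))
theorem8 em PROP K _ M₁ M₂ _ _ w₁ w₂ σ κ Λ Λ⁺ supσ leastκ supΛ succΛ =
  let
    θ₁ , w₁⊩θ₁ , θ₁⇔ = characteristicFormula em Λ⁺ M₁ M₂ |W₁|≺Λ⁺ |W₂|≺Λ⁺ w₁
    θ₂ , w₂⊩θ₂ , θ₂⇔ = characteristicFormula em Λ⁺ M₂ M₁ |W₂|≺Λ⁺ |W₁|≺Λ⁺ w₂
  in (θ₁ , w₁⊩θ₁ , θ₁⇔ w₂) , (θ₂ , w₂⊩θ₂ , flipped ⇔-∘ θ₂⇔ w₁)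
  where
  σ≺Λ⁺ : σ ≺ Λ⁺
  -- The chain is σ ≤ κ ≤ 2^κ ≤ Λ < Λ⁺.
  σ≺Λ⁺ = ↣-≺-trans
    (IsSup.upperʳ supΛ ↣-∘ (A↣2^A (lowerExcludedMiddle em) κ ↣-∘ IsLeastInfiniteAbove.above leastκ))
    (IsSuccessor.above succΛ)

  |W₁|≺Λ⁺ : W M₁ ≺ Λ⁺
  |W₁|≺Λ⁺ = ↣-≺-trans (IsSup.upperˡ supσ) σ≺Λ⁺

  |W₂|≺Λ⁺ : W M₂ ≺ Λ⁺
  |W₂|≺Λ⁺ = ↣-≺-trans (IsSup.upperʳ supσ) σ≺Λ⁺

  flipped : (∃ λ (B : DirectedBisimulation M₂ M₁) → DirectedBisimulation.Z₁ B w₂ w₁) ⇔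
            (∃ λ (B : DirectedBisimulation M₁ M₂) → DirectedBisimulation.Z₂ B w₂ w₁)
  flipped = mk⇔ (λ (B , h) → flipBisimulation B , h) (λ (B , h) → flipBisimulation B , h)
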